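{- Let $q>2$ be a prime power, let $t>1$ be an integer, and let $f(x)\in\mathbb F_{q^t}[x]$ be a scattered $\mathbb F_q$-linearized polynomial such that $0,1\notin L_f$, where $L_f=\{f(x)/x : x\in\mathbb F_{q^t}^*\}$. Let $Q_f=\mathbb F_{q^t}$ be endowed with the sum of $\mathbb F_{q^t}$, and define, for any $x,m\in Q_f$, $$x\circ m=\begin{cases} xm & \text{if } m\notin L_f,\\ h^{ -1}f(hx) & \text{if } m\in L_f \text{ and } f(h)-mh=0,\ h\neq 0.\end{cases}$$ Then $(Q_f,+,\circ)$ is a (right) quasifield, and its kernel is $K(Q_f)=\mathbb F_q$.
   Context: An $\mathbb F_q$-linearized polynomial in $\mathbb F_{q^t}[x]$ is one of the form $f(x)=\sum_{i=0}^k a_ix^{q^i}$. It is called scattered if for all $y,z\in\mathbb F_{q^t}$ the condition $zf(y)-yf(z)=0$ implies that $y$ and $z$ are linearly dependent over $\mathbb F_q$. In the definition of $\circ$, for $m\in L_f$ the element $h\in\mathbb F_{q^t}^*$ is any nonzero solution of $f(h)=mh$; since $f$ is scattered, $h$ is determined up to a factor in $\mathbb F_q^*$, and the value $h^{ -1}f(hx)$ does not depend on the choice. A (right) quasifield is a triple $(Q,+,\circ)$ where $Q$ is a set, $(Q,+)$ is an abelian group, $(Q^*,\circ)$ is a loop (with $Q^*=Q\setminus\{0\}$), $(x+y)\circ m=x\circ m+y\circ m$ for all $x,y,m\in Q$, and for all $a,b,c\in Q$ with $a\neq b$ the equation $x\circ a=x\circ b+c$ in the unknown $x\in Q$ has a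 unique solution. The kernel of $Q$ is $$K(Q)=\{k\in Q : k\circ(x+y)=k\circ x+k\circ y \text{ and } k\circ(x\circ y)=(k\circ x)\circ y \text{ for all } x,y\in Q\}.$$ -}

module Defs where

open import Algebra.Bundles using (CommutativeRing)
open import Algebra.Core using (Op₁; Op₂)
open import Algebra.Definitions using (Congruent₁; Congruent₂; _DistributesOverʳ_)
open import Algebra.Morphism.Structures using (module RingMorphisms)
import Algebra.Properties.Monoid.Sum as MonoidSum
import Algebra.Properties.Semiring.Exp as SemiringExp
open import Algebra.Structures using (IsAbelianGroup; IsLoop)
open import Data.Fin.Base using (Fin; toℕ)
import Data.Fin.Properties as Fin
open import Data.Nat.Base using (ℕ; suc; _≤_; _^_)
open import Data.Nat.Primality using (Prime)
open import Data.Product using (Σ; ∃; ∃₂; ∃!; _×_; _,_; proj₁)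
open import Data.Vec.Functional using (Vector)
open import Function.Base using (_on_)
open import Function.Bundles using (Inverse)
open import Level using (Level; _⊔_) renaming (suc to lsuc)
open import Relation.Binary.Core using (Rel)
open import Relation.Binary.Definitions using (Decidable)
open import Relation.Binary.PropositionalEquality as ≡ using (_≡_)
import Relation.Binary.Reasoning.Setoid as SetoidReasoning
open import Relation.Nullary.Decidable.Core using (Dec; yes; no; map′; ¬?; _×-dec_)
open import Relation.Nullary.Negation.Core using (¬_)
open import Relation.Unary using (Pred; _∈_)

IsPrimePower : ℕ → Set
IsPrimePower q = ∃₂ λ p e → Prime p × 1 ≤ e × q ≡ p ^ e

-- The inverse is a total function whose value at 0# is irrelevant: only the
-- inverses of nonzero elements are constrained, and only those are used below.
record FiniteField (c ℓ : Level) (n : ℕ) : Set (lsuc (c ⊔ ℓ)) where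
  field
    commutativeRing : CommutativeRing c ℓ
  open CommutativeRing commutativeRing public
  field
    _⁻¹         : Op₁ Carrier
    ⁻¹-cong     : Congruent₁ _≈_ _⁻¹
    0≉1         : ¬ (0# ≈ 1#)
    ⁻¹-inverse  : ∀ {x} → ¬ (x ≈ 0#) → x * x ⁻¹ ≈ 1#
    enumeration : Inverse (≡.setoid (Fin n)) setoid

  infix 8 _⁻¹

  private module E = Inverse enumeration

  _≟_ : Decidable _≈_
  x ≟ y = map′
    (λ eq → trans (sym (E.strictlyInverseˡ x)) (trans (E.to-cong eq) (E.strictlyInverseˡ y)))
    E.from-cong
    (E.from x Fin.≟ E.from y)

-- 𝔽_q as a subfield of 𝔽_{q^t}, presented by its inclusion map.
record Extension (c₁ ℓ₁ c₂ ℓ₂ : Level) (q t : ℕ)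
       : Set (lsuc (c₁ ⊔ ℓ₁ ⊔ c₂ ⊔ ℓ₂)) where
  field
    base : FiniteField c₁ ℓ₁ q
    top  : FiniteField c₂ ℓ₂ (q ^ t)

  module Base = FiniteField base
  module Top  = FiniteField top

  field
    ι                  : Base.Carrier → Top.Carrier
    isRingMonomorphism : RingMorphisms.IsRingMonomorphism Base.rawRing Top.rawRing ι

module _ {a ℓ} {Q : Set a} (_≈_ : Rel Q ℓ) (_+_ : Op₂ Q) where

  record IsRightQuasifield (0# : Q) (-_ : Op₁ Q) (_∘_ : Op₂ Q) : Set (a ⊔ ℓ) where
    Q* : Set (a ⊔ ℓ)
    Q* = Σ Q λ x → ¬ (x ≈ 0#)

    _≈*_ : Rel Q* ℓ
    _≈*_ = _≈_ on proj₁

    field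
      +-isAbelianGroup : IsAbelianGroup _≈_ _+_ 0# -_
      ∘-cong           : Congruent₂ _≈_ _∘_
      ∘-nonzero        : ∀ {x y} → ¬ (x ≈ 0#) → ¬ (y ≈ 0#) → ¬ ((x ∘ y) ≈ 0#)

    _∘*_ : Op₂ Q*
    (x , x≉0) ∘* (y , y≉0) = x ∘ y , ∘-nonzero x≉0 y≉0

    field
      _\\_ _//_        : Op₂ Q*
      ε                : Q*
      ∘*-isLoop        : IsLoop _≈*_ _∘*_ _\\_ _//_ ε
      distribʳ         : _DistributesOverʳ_ _≈_ _∘_ _+_
      uniquelySolvable : ∀ a b c → ¬ (a ≈ b) → ∃! _≈_ λ x → (x ∘ a) ≈ ((x ∘ b) + c)

  Kernel : Op₂ Q → Pred Q (a ⊔ ℓ)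
  Kernel _∘_ k = ∀ x y →
    ((k ∘ (x + y)) ≈ ((k ∘ x) + (k ∘ y))) ×
    ((k ∘ (x ∘ y)) ≈ ((k ∘ x) ∘ y))

module Linearized {c₁ ℓ₁ c₂ ℓ₂ : Level} {q t : ℕ} (E : Extension c₁ ℓ₁ c₂ ℓ₂ q t) where
  open Extension E
  open Top
  open MonoidSum +-monoid using (sum⁺-syntax; sum-cong-≋)
  open SemiringExp semiring using (^-congˡ) renaming (_^_ to _^^_)

  record LinearizedPolynomial : Set c₂ where
    field
      k     : ℕ
      coeff : Vector Carrier (suc k)

    ⟦_⟧ : Carrier → Carrier
    ⟦_⟧ x = ∑[ i ≤ k ] (coeff i * x ^^ (q ^ toℕ i))

    ⟦⟧-cong : Congruent₁ _≈_ ⟦_⟧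
    ⟦⟧-cong x≈y = sum-cong-≋ {suc k} λ i → *-congˡ {coeff i} (^-congˡ (q ^ toℕ i) x≈y)

  open LinearizedPolynomial public using (⟦_⟧; ⟦⟧-cong)

  𝔽q : Pred Carrier (c₁ ⊔ ℓ₂)
  𝔽q x = ∃ λ a → ι a ≈ x

  LinearlyDependent : Carrier → Carrier → Set (c₁ ⊔ ℓ₁ ⊔ ℓ₂)
  LinearlyDependent y z = ∃₂ λ a b →
    ¬ ((a Base.≈ Base.0#) × (b Base.≈ Base.0#)) × ι a * y + ι b * z ≈ 0#

  Scattered : LinearizedPolynomial → Set (c₁ ⊔ ℓ₁ ⊔ c₂ ⊔ ℓ₂)
  Scattered f = ∀ y z → z * ⟦ f ⟧ y - y * ⟦ f ⟧ z ≈ 0# → LinearlyDependent y z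

  L : LinearizedPolynomial → Pred Carrier (c₂ ⊔ ℓ₂)
  L f m = ∃ λ x → ¬ (x ≈ 0#) × m ≈ ⟦ f ⟧ x * x ⁻¹

  _∈L?_ : ∀ m f → Dec (m ∈ L f)
  m ∈L? f = map′
    (λ (i , p) → I.to i , p)
    (λ (x , x≉0 , m≈) → I.from x ,
      (λ eq → x≉0 (trans (sym (I.strictlyInverseˡ x)) eq)) ,
      trans m≈ (*-cong (⟦⟧-cong f (sym (I.strictlyInverseˡ x))) (⁻¹-cong (sym (I.strictlyInverseˡ x)))))
    (Fin.any? λ i → ¬? (I.to i ≟ 0#) ×-dec (m ≟ (⟦ f ⟧ (I.to i) * I.to i ⁻¹)))
    where module I = Inverse enumeration

  Choice : LinearizedPolynomial → Set (c₂ ⊔ ℓ₂)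
  Choice f = ∀ m → m ∈ L f → ∃ λ h → ¬ (h ≈ 0#) × ⟦ f ⟧ h - m * h ≈ 0#

  -- Choices always exist, so quantifying over them is not vacuous.
  choice : ∀ f → Choice f
  choice f m (x , x≉0 , m≈) = x , x≉0 , (begin
    ⟦ f ⟧ x - m * x                    ≈⟨ +-congˡ (-‿cong (*-congʳ m≈)) ⟩
    ⟦ f ⟧ x - ⟦ f ⟧ x * x ⁻¹ * x       ≈⟨ +-congˡ (-‿cong (*-assoc _ _ _)) ⟩
    ⟦ f ⟧ x - ⟦ f ⟧ x * (x ⁻¹ * x)     ≈⟨ +-congˡ (-‿cong (*-congˡ (*-comm _ _))) ⟩
    ⟦ f ⟧ x - ⟦ f ⟧ x * (x * x ⁻¹)     ≈⟨ +-congˡ (-‿cong (*-congˡ (⁻¹-inverse x≉0))) ⟩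
    ⟦ f ⟧ x - ⟦ f ⟧ x * 1#             ≈⟨ +-congˡ (-‿cong (*-identityʳ _)) ⟩
    ⟦ f ⟧ x - ⟦ f ⟧ x                  ≈⟨ -‿inverseʳ _ ⟩
    0#                                 ∎)
    where open SetoidReasoning setoid

  module _ (f : LinearizedPolynomial) (root : Choice f) where

    twisted : Op₂ Carrier
    twisted x m with m ∈L? f
    ... | no  _   = x * m
    ... | yes m∈L = let h , _ = root m m∈L in h ⁻¹ * ⟦ f ⟧ (h * x)

{-# OPTIONS --safe #-}

-- By scatteredness, x ∘ m ≈ x ∘ n with x ≠ 0 forces m ≈ n; since each _∘ m is
-- additive and the field is finite, this one cancellation law yields all the
-- bijectivity a quasifield needs.  For the kernel, suppose k ∉ 𝔽q.  Then
-- k ∘ m ≈ k * m exactly for m ∉ L, so if k ∘_ is additive, adding an element of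
-- L carries the complement of L into L.  But every m ∈ L comes with at least
-- q − 1 ≥ 2 solutions h ≠ 0 of f(h) = m h, and for different m these are
-- different, so L has fewer than half of the elements of the field,
-- too few to contain a translate of its complement.

module Submission where

open import Algebra.Bundles using (CommutativeMonoid; CommutativeRing)
import Algebra.Properties.AbelianGroup as AbelianGroupProperties
import Algebra.Properties.CommutativeMonoid.Sum as CommutativeMonoidSum
import Algebra.Properties.CommutativeSemigroup as CommutativeSemigroupProperties
import Algebra.Properties.CommutativeSemiring.Binomial as Binomial
import Algebra.Properties.CommutativeSemiring.Exp as Exp
import Algebra.Properties.Group as GroupProperties
import Algebra.Properties.Ring as RingProperties
import Algebra.Properties.Semiring.Mult as Mult
import Algebra.Properties.Semiring.Sum as SemiringSum
open import Algebra.Morphism.Structures using (module RingMorphisms)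
open import Data.Fin.Base using (Fin; zero; suc; toℕ; fromℕ; inject₁; punchIn; punchOut)
open import Data.Fin.Patterns using (0F; 1F)
open import Data.Fin.Permutation using (Permutation; permutation)
import Data.Fin.Properties as Fin
open import Data.Nat.Base as ℕ using (ℕ; zero; suc; _<_; _∸_; _!; z≤n; s≤s)
open import Data.Nat.Combinatorics using (_C_; nCk≡n!/k![n-k]!; k![n∸k]!∣n!; nCn≡1)
open import Data.Nat.DivMod using (m/n*n≡m)
open import Data.Nat.Divisibility using (_∣_; divides; ∣⇒≤; m∣m*n; ∣1⇒≡1)
open import Data.Nat.Primality using (Prime; euclidsLemma; prime⇒nonTrivial)
import Data.Nat.Properties as ℕ
open import Data.Product using (∃; ∃!; _×_; _,_; proj₁; proj₂)
open import Data.Sum.Base using ([_,_]′)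
open import Function.Base using (id) renaming (_∘_ to _⊚_)
open import Function.Bundles using (Inverse)
open import Function.Definitions using (Injective)
open import Level using (Level; _⊔_)
open import Relation.Binary.Core using (_Preserves_⟶_)
open import Relation.Binary.PropositionalEquality.Core as ≡ using (_≡_; _≢_)
import Relation.Binary.Reasoning.Setoid as SetoidReasoning
open import Relation.Nullary using (¬_; Dec; yes; no; contradiction)
open import Relation.Nullary.Decidable using (map′; ¬?; _×-dec_; decidable-stable)
open import Relation.Unary using (_∈_; _∉_; _≐_)
open import Defs

-- Pigeonhole and finite sums

injective⇒surjective : ∀ {n} {f : Fin n → Fin n} → Injective _≡_ _≡_ f →
                       ∀ j → ∃ λ i → f i ≡ j
injective⇒surjective {suc n} {f} f-inj j with Fin.any? (λ i → f i Fin.≟ j)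
... | yes found = found
-- Punching out a missed value `j` would inject `Fin (suc n)` into `Fin n`.
... | no  ¬hit  = contradiction
  (Fin.injective⇒≤ {f = λ i → punchOut (j≢f i)} λ eq →
    f-inj (Fin.punchOut-injective (j≢f _) (j≢f _) eq))
  ℕ.1+n≰n
  where
  j≢f : ∀ i → j ≢ f i
  j≢f i j≡fi = ¬hit (i , ≡.sym j≡fi)

module _ {c ℓ} (M : CommutativeMonoid c ℓ) where
  open CommutativeMonoid M
  open CommutativeMonoidSum M

  sum-single : ∀ {n} (v : Fin n → Carrier) i → (∀ j → j ≢ i → v j ≈ ε) → sum v ≈ v i
  sum-single {suc n} v i v≈ε = begin
    sum v                              ≈⟨ sum-remove v ⟩
    v i ∙ sum (λ j → v (punchIn i j))  ≈⟨ ∙-congˡ (sum-cong-≋ λ j → v≈ε _ (Fin.punchInᵢ≢i i j)) ⟩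
    v i ∙ sum {n} (λ _ → ε)            ≈⟨ ∙-congˡ (sum-replicate-zero n) ⟩
    v i ∙ ε                            ≈⟨ identityʳ _ ⟩
    v i                                ∎
    where open SetoidReasoning setoid

-- Binomial coefficients modulo a prime

prime∤! : ∀ {p} → Prime p → ∀ {k} → k < p → ¬ p ∣ k !
prime∤! pp {zero}  _   p∣1 = ℕ.nonTrivial⇒≢1 {{prime⇒nonTrivial pp}} (∣1⇒≡1 p∣1)
prime∤! pp {suc k} k<p p∣  = [ (λ p∣k → ℕ.<⇒≱ k<p (∣⇒≤ p∣k)) , prime∤! pp (ℕ.<⇒≤ k<p) ]′
  (euclidsLemma (suc k) (k !) pp p∣)

-- The prime divides `p !`, the product of `p C k` with two factorials whose factors are all below
-- `p`, so by Euclid's lemma it must divide the binomial coefficient.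
prime∣nCk : ∀ {p} → Prime p → ∀ {k} → 0 < k → k < p → p ∣ p C k
prime∣nCk {p} pp {k} 0<k k<p =
  [ id , (λ d → contradiction d p∤denominator) ]′
    (euclidsLemma (p C k) _ pp (≡.subst (p ∣_) (≡.sym C*denominator) (n∣n! k<p)))
  where
  k≤p = ℕ.<⇒≤ k<p
  instance _ = k ℕ.!* (p ∸ k) !≢0
  C*denominator : (p C k) ℕ.* (k ! ℕ.* (p ∸ k) !) ≡ p !
  C*denominator = ≡.trans (≡.cong (ℕ._* (k ! ℕ.* (p ∸ k) !)) (nCk≡n!/k![n-k]! k≤p))
                          (m/n*n≡m (k![n∸k]!∣n! k≤p))
  n∣n! : ∀ {n} → k < n → n ∣ n !
  n∣n! {suc n} _ = m∣m*n (n !)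
  p∤denominator : ¬ p ∣ k ! ℕ.* (p ∸ k) !
  p∤denominator d = [ prime∤! pp k<p , prime∤! pp (ℕ.∸-monoʳ-< 0<k k≤p) ]′
    (euclidsLemma (k !) _ pp d)

-- Additivity of the Frobenius map

module Frobenius {c ℓ} (R : CommutativeRing c ℓ) {p} (pp : Prime p) where
  open CommutativeRing R
  open Exp commutativeSemiring
  open Mult semiring renaming (_×_ to _·_)
  open SemiringSum semiring using (sum; sum-init-last; sum-cong-≋; sum-replicate-zero)
  open SetoidReasoning setoid

  module _ (p·1≈0 : p · 1# ≈ 0#) where

    ∣⇒·≈0 : ∀ {m} → p ∣ m → ∀ x → m · x ≈ 0#
    ∣⇒·≈0 (divides k ≡.refl) x = begin
      (k ℕ.* p) · x         ≈⟨ ×-congˡ (ℕ.*-comm k p) ⟩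
      (p ℕ.* k) · x         ≈⟨ ×-assocˡ x p k ⟨
      p · (k · x)           ≈⟨ ×-congʳ p (*-identityˡ _) ⟨
      p · (1# * (k · x))    ≈⟨ ×-assoc-* p 1# _ ⟨
      (p · 1#) * (k · x)    ≈⟨ *-congʳ p·1≈0 ⟩
      0# * (k · x)          ≈⟨ zeroˡ _ ⟩
      0#                    ∎

    -- Only the two end terms of the binomial expansion survive: `p` divides every coefficient
    -- strictly between them.
    ^p-homo-+ : ∀ x y → (x + y) ^ p ≈ x ^ p + y ^ p
    ^p-homo-+ x y = expand p ≡.refl
      where
      -- The exponent is a variable here so that it can be matched as a successor, which splitting
      -- off both end terms requires; zero is not prime.
      expand : ∀ m → m ≡ p → (x + y) ^ m ≈ x ^ m + y ^ m
      expand zero    ≡.refl = contradiction pp λ ()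
      expand (suc r) ≡.refl = begin
        (x + y) ^ p                    ≈⟨ Binomial.theorem commutativeSemiring p x y ⟩
        term 0F + sum tail             ≈⟨ +-cong first (sum-init-last tail) ⟩
        y ^ p + (sum (tail ⊚ inject₁) + tail (fromℕ r))
                                       ≈⟨ +-congˡ (+-cong (trans (sum-cong-≋ middle) (sum-replicate-zero r)) last) ⟩
        y ^ p + (0# + x ^ p)           ≈⟨ +-congˡ (+-identityˡ _) ⟩
        y ^ p + x ^ p                  ≈⟨ +-comm _ _ ⟩
        x ^ p + y ^ p                  ∎
        where
        term : Fin (suc p) → Carrier
        term k = (p C toℕ k) · (x ^ toℕ k * y ^ (p ∸ toℕ k))
        tail : Fin p → Carrier
        tail = term ⊚ suc
        first : term 0F ≈ y ^ p
        first = trans (×-homo-1 _) (*-identityˡ _)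
        middle : ∀ i → tail (inject₁ i) ≈ 0#
        middle i = ∣⇒·≈0 (prime∣nCk pp (s≤s z≤n)
          (s≤s (≡.subst (_< r) (≡.sym (Fin.toℕ-inject₁ i)) (Fin.toℕ<n i)))) _
        last : tail (fromℕ r) ≈ x ^ p
        last rewrite Fin.toℕ-fromℕ r | nCn≡1 p | ℕ.n∸n≡0 r = trans (×-homo-1 _) (*-identityʳ _)

    ^pᵏ-homo-+ : ∀ k x y → (x + y) ^ (p ℕ.^ k) ≈ x ^ (p ℕ.^ k) + y ^ (p ℕ.^ k)
    ^pᵏ-homo-+ zero    x y = trans (*-identityʳ _) (sym (+-cong (*-identityʳ _) (*-identityʳ _)))
    ^pᵏ-homo-+ (suc k) x y = begin
      (x + y) ^ (p ℕ.* pᵏ)         ≈⟨ ^-assocʳ _ p pᵏ ⟨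
      ((x + y) ^ p) ^ pᵏ           ≈⟨ ^-congˡ pᵏ (^p-homo-+ x y) ⟩
      (x ^ p + y ^ p) ^ pᵏ         ≈⟨ ^pᵏ-homo-+ k _ _ ⟩
      (x ^ p) ^ pᵏ + (y ^ p) ^ pᵏ  ≈⟨ +-cong (^-assocʳ x p pᵏ) (^-assocʳ y p pᵏ) ⟩
      x ^ (p ℕ.* pᵏ) + y ^ (p ℕ.* pᵏ) ∎
      where pᵏ = p ℕ.^ k

-- Finite fields: permutations, characteristic, Fermat's theorem

module FiniteFieldProperties {c ℓ n} (F : FiniteField c ℓ n) where
  open FiniteField F
  open Exp commutativeSemiring
  open Mult semiring renaming (_×_ to _·_)
  open Inverse enumeration using (to; from; from-cong; strictlyInverseˡ; strictlyInverseʳ)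
  open CommutativeSemigroupProperties *-commutativeSemigroup using (x∙yz≈y∙xz)
  open SetoidReasoning setoid

  x*[x⁻¹*y]≈y : ∀ {x} → ¬ (x ≈ 0#) → ∀ y → x * (x ⁻¹ * y) ≈ y
  x*[x⁻¹*y]≈y {x} x≉0 y = begin
    x * (x ⁻¹ * y)  ≈⟨ *-assoc _ _ _ ⟨
    x * x ⁻¹ * y    ≈⟨ *-congʳ (⁻¹-inverse x≉0) ⟩
    1# * y          ≈⟨ *-identityˡ y ⟩
    y               ∎

  *-cancelˡ : ∀ {x y z} → ¬ (x ≈ 0#) → x * y ≈ x * z → y ≈ z
  *-cancelˡ {x} {y} {z} x≉0 eq = begin
    y                ≈⟨ x*[x⁻¹*y]≈y x≉0 y ⟨
    x * (x ⁻¹ * y)   ≈⟨ x∙yz≈y∙xz _ _ _ ⟩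
    x ⁻¹ * (x * y)   ≈⟨ *-congˡ eq ⟩
    x ⁻¹ * (x * z)   ≈⟨ x∙yz≈y∙xz _ _ _ ⟩
    x * (x ⁻¹ * z)   ≈⟨ x*[x⁻¹*y]≈y x≉0 z ⟩
    z                ∎

  xy≈0⇒y≈0 : ∀ {x y} → ¬ (x ≈ 0#) → x * y ≈ 0# → y ≈ 0#
  xy≈0⇒y≈0 x≉0 eq = *-cancelˡ x≉0 (trans eq (sym (zeroʳ _)))

  *-nonzero : ∀ {x y} → ¬ (x ≈ 0#) → ¬ (y ≈ 0#) → ¬ (x * y ≈ 0#)
  *-nonzero x≉0 y≉0 eq = y≉0 (xy≈0⇒y≈0 x≉0 eq)

  x^k≈0⇒x≈0 : ∀ {x} k → x ^ k ≈ 0# → x ≈ 0#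
  x^k≈0⇒x≈0     zero    eq = contradiction (sym eq) 0≉1
  x^k≈0⇒x≈0 {x} (suc k) eq with x ≟ 0#
  ... | yes x≈0 = x≈0
  ... | no  x≉0 = x^k≈0⇒x≈0 k (xy≈0⇒y≈0 x≉0 eq)

  to-injective : ∀ {i j} → to i ≈ to j → i ≡ j
  to-injective eq = ≡.trans (≡.sym (strictlyInverseʳ _)) (≡.trans (from-cong eq) (strictlyInverseʳ _))

  from-injective : ∀ {x y} → from x ≡ from y → x ≈ y
  from-injective {x} {y} eq =
    trans (sym (strictlyInverseˡ x)) (trans (reflexive (≡.cong to eq)) (strictlyInverseˡ y))

  -- Otherwise the test for zero would determine each element, embedding the field into `Fin 2`.
  element≉0,1 : 2 < n → ∃ λ x → ¬ (x ≈ 0#) × ¬ (x ≈ 1#)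
  element≉0,1 2<n with Fin.any? (λ i → ¬? (to i ≟ 0#) ×-dec ¬? (to i ≟ 1#))
  ... | yes (i , i≉0,1) = to i , i≉0,1
  ... | no  none        = contradiction (Fin.injective⇒≤ (to-injective ⊚ isZero-injective _ _)) (ℕ.<⇒≱ 2<n)
    where
    isZero : Fin n → Fin 2
    isZero i with to i ≟ 0#
    ... | yes _ = 1F
    ... | no  _ = 0F

    ≉0⇒≈1 : ∀ i → ¬ (to i ≈ 0#) → to i ≈ 1#
    ≉0⇒≈1 i i≉0 = decidable-stable (to i ≟ 1#) λ i≉1 → none (i , i≉0 , i≉1)

    isZero-injective : ∀ i j → isZero i ≡ isZero j → to i ≈ to j
    isZero-injective i j eq with to i ≟ 0# | to j ≟ 0#
    isZero-injective i j eq | yes i≈0 | yes j≈0 = trans i≈0 (sym j≈0)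
    isZero-injective i j eq | no  i≉0 | no  j≉0 = trans (≉0⇒≈1 i i≉0) (sym (≉0⇒≈1 j j≉0))

  module _ {g : Carrier → Carrier} (g-inj : Injective _≈_ _≈_ g) where

    private
      index : Fin n → Fin n
      index = from ⊚ g ⊚ to
      index-inj : Injective _≡_ _≡_ index
      index-inj = to-injective ⊚ g-inj ⊚ from-injective

    surjective : ∀ y → ∃ λ x → g x ≈ y
    surjective y with i , eq ← injective⇒surjective index-inj (from y) = to i , from-injective eq

    module _ {m ℓm} (M : CommutativeMonoid m ℓm) where
      private
        module M = CommutativeMonoid M
        module M-Sum = CommutativeMonoidSum M
        π : Permutation n n
        π = permutation index (proj₁ ⊚ injective⇒surjective index-inj)
          (λ j → proj₂ (injective⇒surjective index-inj j))
          (λ i → index-inj (proj₂ (injective⇒surjective index-inj (index i))))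

      -- By finiteness the injection `g` permutes the indices. The monoid is arbitrary because both
      -- the sum and the product over the field are reindexed below.
      sum-reindex : (v : Carrier → M.Carrier) → v Preserves _≈_ ⟶ M._≈_ →
                    M-Sum.sum (v ⊚ to) M.≈ M-Sum.sum (v ⊚ g ⊚ to)
      sum-reindex v v-cong = M.trans (M-Sum.sum-permute (v ⊚ to) π)
        (M-Sum.sum-cong-≋ λ i → v-cong (strictlyInverseˡ (g (to i))))

  -- Translation by 1 permutes the field, so ∑ x = ∑ (x + 1) = ∑ x + n · 1.
  n·1≈0 : n · 1# ≈ 0#
  n·1≈0 = identityʳ-unique total _ (sym (begin
    total                              ≈⟨ sum-reindex (+-cancelʳ 1# _ _) +-commutativeMonoid id id ⟩
    sum (λ i → to i + 1#)              ≈⟨ ∑-distrib-+ to (λ _ → 1#) ⟩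
    total + sum {n} (λ _ → 1#)         ≈⟨ +-congˡ (sum-replicate n) ⟩
    total + n · 1#                     ∎))
    where
    open CommutativeMonoidSum +-commutativeMonoid
    open GroupProperties +-group using (identityʳ-unique) renaming (∙-cancelʳ to +-cancelʳ)
    total = sum to

  -- Since `n · 1#` is the `k`th power of `p · 1#`, the latter is nilpotent, and a field has no
  -- nonzero nilpotents.
  characteristic : ∀ {p k} → n ≡ p ℕ.^ k → p · 1# ≈ 0#
  characteristic {p} {k} n≡pᵏ = x^k≈0⇒x≈0 k (begin
    (p · 1#) ^ k     ≈⟨ pᵏ·1 k ⟨
    (p ℕ.^ k) · 1#   ≈⟨ ×-congˡ n≡pᵏ ⟨
    n · 1#           ≈⟨ n·1≈0 ⟩
    0#               ∎)
    where
    pᵏ·1 : ∀ k → (p ℕ.^ k) · 1# ≈ (p · 1#) ^ k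
    pᵏ·1 zero    = ×-homo-1 1#
    pᵏ·1 (suc k) = trans (×1-homo-* p (p ℕ.^ k)) (*-congˡ (pᵏ·1 k))

  -- Multiplication by a ≠ 0 permutes the field.  To take the product over all
  -- of it rather than over the nonzero elements, 0 is replaced by 1 in u; the
  -- correction δ contributes the extra factor a.
  x^n≈x : ∀ a → a ^ n ≈ a
  x^n≈x a with a ≟ 0#
  ... | yes a≈0 = trans (^-congˡ n a≈0) (trans (0^ (from 0#)) (sym a≈0))
    -- The index of zero shows that the exponent is positive; the zeroth power would be one.
    where
    0^ : ∀ {m} → Fin m → 0# ^ m ≈ 0#
    0^ {suc m} _ = zeroˡ _
  ... | no  a≉0 = *-cancelˡ (prod≉0 (u ⊚ to) (u≉0 ⊚ to)) (begin
    prod (u ⊚ to) * a ^ n                      ≈⟨ *-comm _ _ ⟩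
    a ^ n * prod (u ⊚ to)                      ≈⟨ *-congʳ (prod-replicate n) ⟨
    prod {n} (λ _ → a) * prod (u ⊚ to)         ≈⟨ ∏-distrib-* (λ _ → a) (u ⊚ to) ⟨
    prod (λ i → a * u (to i))                  ≈⟨ prod-cong (twist ⊚ to) ⟩
    prod (λ i → u (a * to i) * δ (to i))       ≈⟨ ∏-distrib-* (λ i → u (a * to i)) (δ ⊚ to) ⟩
    prod (λ i → u (a * to i)) * prod (δ ⊚ to)  ≈⟨ *-cong (sym permuted) prod-δ ⟩
    prod (u ⊚ to) * a                          ∎)
    where
    open CommutativeMonoidSum *-commutativeMonoid using ()
      renaming (sum to prod; sum-replicate to prod-replicate; ∑-distrib-+ to ∏-distrib-*; sum-cong-≋ to prod-cong)

    u δ : Carrier → Carrier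
    u x with x ≟ 0#
    ... | yes _ = 1#
    ... | no  _ = x
    δ x with x ≟ 0#
    ... | yes _ = a
    ... | no  _ = 1#

    u-cong : u Preserves _≈_ ⟶ _≈_
    u-cong {x} {y} x≈y with x ≟ 0# | y ≟ 0#
    ... | yes _   | yes _   = refl
    ... | yes x≈0 | no  y≉0 = contradiction (trans (sym x≈y) x≈0) y≉0
    ... | no  x≉0 | yes y≈0 = contradiction (trans x≈y y≈0) x≉0
    ... | no  _   | no  _   = x≈y

    u≉0 : ∀ x → ¬ (u x ≈ 0#)
    u≉0 x with x ≟ 0#
    ... | yes _   = 0≉1 ⊚ sym
    ... | no  x≉0 = x≉0

    permuted : prod (u ⊚ to) ≈ prod (λ i → u (a * to i))
    permuted = sum-reindex (*-cancelˡ a≉0) *-commutativeMonoid u u-cong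

    prod≉0 : ∀ {m} (v : Fin m → Carrier) → (∀ i → ¬ (v i ≈ 0#)) → ¬ (prod v ≈ 0#)
    prod≉0 {zero}  v v≉0 = 0≉1 ⊚ sym
    prod≉0 {suc m} v v≉0 = *-nonzero (v≉0 0F) (prod≉0 (v ⊚ suc) (v≉0 ⊚ suc))

    twist : ∀ x → a * u x ≈ u (a * x) * δ x
    twist x with x ≟ 0# | (a * x) ≟ 0#
    ... | yes _   | yes _    = *-comm _ _
    ... | yes x≈0 | no  ax≉0 = contradiction (trans (*-congˡ x≈0) (zeroʳ a)) ax≉0
    ... | no  x≉0 | yes ax≈0 = contradiction ax≈0 (*-nonzero a≉0 x≉0)
    ... | no  _   | no  _    = sym (*-identityʳ _)

    δ-zero : ∀ {x} → x ≈ 0# → δ x ≈ a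
    δ-zero {x} x≈0 with x ≟ 0#
    ... | yes _   = refl
    ... | no  x≉0 = contradiction x≈0 x≉0

    δ-nonzero : ∀ {x} → ¬ (x ≈ 0#) → δ x ≈ 1#
    δ-nonzero {x} x≉0 with x ≟ 0#
    ... | yes x≈0 = contradiction x≈0 x≉0
    ... | no  _   = refl

    prod-δ : prod (δ ⊚ to) ≈ a
    prod-δ = trans
      (sum-single *-commutativeMonoid (δ ⊚ to) (from 0#) λ j j≢ →
        δ-nonzero λ eq → j≢ (≡.trans (≡.sym (strictlyInverseʳ j)) (from-cong eq)))
      (δ-zero (strictlyInverseˡ 0#))

-- Linearity of linearized polynomials over the base field

module TwistedMultiplication {c₁ ℓ₁ c₂ ℓ₂ q t} (q-primePower : IsPrimePower q)
  (E : Extension c₁ ℓ₁ c₂ ℓ₂ q t) where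
  open Extension E
  open Top
  open Linearized E
  open Exp commutativeSemiring renaming (_^_ to _^^_)
  open FiniteFieldProperties top
  open Inverse enumeration using (to; from; from-cong; strictlyInverseˡ)
  open RingMorphisms Base.rawRing rawRing using (module IsRingMonomorphism)
  open IsRingMonomorphism isRingMonomorphism
    renaming (injective to ι-injective; ⟦⟧-cong to ι-cong; *-homo to ι-*;
              0#-homo to ι-0; 1#-homo to ι-1; -‿homo to ι-‿-)
  open CommutativeSemigroupProperties *-commutativeSemigroup
    using (x∙yz≈y∙xz; x∙yz≈y∙zx; interchange)
  open CommutativeSemigroupProperties +-commutativeSemigroup using ()
    renaming (interchange to +-interchange)
  open AbelianGroupProperties +-abelianGroup using (xyx⁻¹≈y; ⁻¹-∙-comm)
    renaming (x∙y⁻¹≈ε⇒x≈y to x-y≈0⇒x≈y; x≈y⇒x∙y⁻¹≈ε to x≈y⇒x-y≈0;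
              inverseˡ-unique to +-inverseˡ-unique; inverseʳ-unique to +-inverseʳ-unique;
              identityˡ-unique to +-identityˡ-unique; ∙-cancelˡ to +-cancelˡ; ∙-cancelʳ to +-cancelʳ)
  open RingProperties ring using (-‿distribˡ-*)
  open SetoidReasoning setoid
  private
    module BaseProperties = FiniteFieldProperties base
    module BaseExp = Exp Base.commutativeSemiring

  ι≉0 : ∀ {a} → ¬ (a Base.≈ Base.0#) → ¬ (ι a ≈ 0#)
  ι≉0 a≉0 ιa≈0 = a≉0 (ι-injective (trans ιa≈0 (sym ι-0)))

  -- This decision makes the proof by contradiction in `Kernel⊆𝔽q` constructive.
  ∈𝔽q? : ∀ x → Dec (x ∈ 𝔽q)
  ∈𝔽q? x = map′ (λ (i , eq) → BaseEnum.to i , eq)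
    (λ (a , eq) → BaseEnum.from a , trans (ι-cong (BaseEnum.strictlyInverseˡ a)) eq)
    (Fin.any? λ i → ι (BaseEnum.to i) ≟ x)
    where module BaseEnum = Inverse Base.enumeration

  ι-^ : ∀ a m → ι (a BaseExp.^ m) ≈ ι a ^^ m
  ι-^ a zero    = ι-1
  ι-^ a (suc m) = trans (ι-* a _) (*-congˡ (ι-^ a m))

  -- Elements of the base field satisfy Fermat's identity with exponent `q`, which is then iterated.
  ι^qⁱ : ∀ a i → ι a ^^ (q ℕ.^ i) ≈ ι a
  ι^qⁱ a zero    = *-identityʳ _
  ι^qⁱ a (suc i) = begin
    ι a ^^ (q ℕ.* q ℕ.^ i)     ≈⟨ ^-assocʳ (ι a) q _ ⟨
    (ι a ^^ q) ^^ (q ℕ.^ i)    ≈⟨ ^-congˡ (q ℕ.^ i) (trans (sym (ι-^ a q)) (ι-cong (BaseProperties.x^n≈x a))) ⟩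
    ι a ^^ (q ℕ.^ i)           ≈⟨ ι^qⁱ a i ⟩
    ι a                        ∎

  -- With `q ≡ p ^ e`, the big field has `p ^ (e * t)` elements, hence characteristic `p`, and
  -- raising to the power `q ^ i` is an iterate of Frobenius.
  ^qⁱ-homo-+ : ∀ i x y → (x + y) ^^ (q ℕ.^ i) ≈ x ^^ (q ℕ.^ i) + y ^^ (q ℕ.^ i)
  ^qⁱ-homo-+ i x y = let p , e , pp , _ , q≡pᵉ = q-primePower in homo p e pp q≡pᵉ
    where
    q^j≡ : ∀ p e → q ≡ p ℕ.^ e → ∀ j → q ℕ.^ j ≡ p ℕ.^ (e ℕ.* j)
    q^j≡ p e eq j = ≡.trans (≡.cong (ℕ._^ j) eq) (ℕ.^-*-assoc p e j)
    homo : ∀ p e → Prime p → q ≡ p ℕ.^ e →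
           (x + y) ^^ (q ℕ.^ i) ≈ x ^^ (q ℕ.^ i) + y ^^ (q ℕ.^ i)
    homo p e pp eq rewrite q^j≡ p e eq i =
      Frobenius.^pᵏ-homo-+ commutativeRing pp (characteristic {p} {e ℕ.* t} (q^j≡ p e eq t)) (e ℕ.* i) x y

  module _ (f : LinearizedPolynomial) where
    open LinearizedPolynomial f using (k; coeff)
    open SemiringSum semiring using (sum-cong-≋; ∑-distrib-+; *-distribˡ-sum)

    private
      monomial : Carrier → Fin (suc k) → Carrier
      monomial x i = coeff i * x ^^ (q ℕ.^ toℕ i)

    ⟦⟧-+ : ∀ x y → ⟦ f ⟧ (x + y) ≈ ⟦ f ⟧ x + ⟦ f ⟧ y
    ⟦⟧-+ x y = trans
      (sum-cong-≋ λ i → trans (*-congˡ (^qⁱ-homo-+ (toℕ i) x y)) (distribˡ (coeff i) _ _))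
      (∑-distrib-+ (monomial x) (monomial y))

    ⟦⟧-ι* : ∀ a x → ⟦ f ⟧ (ι a * x) ≈ ι a * ⟦ f ⟧ x
    ⟦⟧-ι* a x = trans
      (sum-cong-≋ λ i → begin
        coeff i * (ι a * x) ^^ (q ℕ.^ toℕ i)
          ≈⟨ *-congˡ (^-distrib-* (ι a) x (q ℕ.^ toℕ i)) ⟩
        coeff i * (ι a ^^ (q ℕ.^ toℕ i) * x ^^ (q ℕ.^ toℕ i))
          ≈⟨ *-congˡ (*-congʳ (ι^qⁱ a (toℕ i))) ⟩
        coeff i * (ι a * x ^^ (q ℕ.^ toℕ i))
          ≈⟨ x∙yz≈y∙xz _ _ _ ⟩
        ι a * monomial x i ∎)
      (sym (*-distribˡ-sum (ι a) (monomial x)))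

  -- Eigenvalues of a scattered linear map

  module ScatteredMap
    (φ : Carrier → Carrier) (φ-cong : φ Preserves _≈_ ⟶ _≈_)
    (φ-+ : ∀ x y → φ (x + y) ≈ φ x + φ y)
    (φ-ι* : ∀ a x → φ (ι a * x) ≈ ι a * φ x)
    (scattered : ∀ y z → z * φ y - y * φ z ≈ 0# → LinearlyDependent y z)
    where

    -- For `φ = ⟦ f ⟧` this is membership in `L f`, written without division.
    Eigenvalue : Carrier → Set _
    Eigenvalue m = ∃ λ h → ¬ (h ≈ 0#) × φ h ≈ m * h

    Eigenvalue-resp : ∀ {m n} → m ≈ n → Eigenvalue m → Eigenvalue n
    Eigenvalue-resp m≈n (h , h≉0 , φh) = h , h≉0 , trans φh (*-congʳ m≈n)

    -- Scatteredness gives a nontrivial relation `ι a * y + ι b * z ≈ 0#`. Here `a` cannot vanish,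
    -- since then `z ≉ 0` would force `b` to vanish too; so one may solve for `y`.
    proportional : ∀ {y z} → ¬ (z ≈ 0#) → z * φ y ≈ y * φ z → ∃ λ c → y ≈ ι c * z
    proportional {y} {z} z≉0 eq = -b/a , *-cancelˡ (ι≉0 a≉0) (begin
      ι a * y                         ≈⟨ +-inverseˡ-unique _ _ ay+bz≈0 ⟩
      - (ι b * z)                     ≈⟨ -‿distribˡ-* _ _ ⟩
      - ι b * z                       ≈⟨ *-congʳ (ι-‿- b) ⟨
      ι (Base.- b) * z                ≈⟨ *-congʳ (ι-cong a*-b/a) ⟨
      ι (a Base.* -b/a) * z           ≈⟨ *-congʳ (ι-* a -b/a) ⟩
      ι a * ι -b/a * z                ≈⟨ *-assoc _ _ _ ⟩
      ι a * (ι -b/a * z)              ∎)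
      where
      dependent = scattered y z (x≈y⇒x-y≈0 eq)
      a = proj₁ dependent
      b = proj₁ (proj₂ dependent)
      ay+bz≈0 : ι a * y + ι b * z ≈ 0#
      ay+bz≈0 = proj₂ (proj₂ (proj₂ dependent))
      a≉0 : ¬ (a Base.≈ Base.0#)
      a≉0 a≈0 = proj₁ (proj₂ (proj₂ dependent)) (a≈0 , ι-injective (trans ιb≈0 (sym ι-0)))
        where
        ιb≈0 : ι b ≈ 0#
        ιb≈0 = xy≈0⇒y≈0 z≉0 (begin
          z * ι b              ≈⟨ *-comm _ _ ⟩
          ι b * z              ≈⟨ +-identityˡ _ ⟨
          0# + ι b * z         ≈⟨ +-congʳ (trans (*-congʳ (trans (ι-cong a≈0) ι-0)) (zeroˡ y)) ⟨
          ι a * y + ι b * z    ≈⟨ ay+bz≈0 ⟩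
          0#                   ∎)
      -b/a = a Base.⁻¹ Base.* (Base.- b)
      a*-b/a : a Base.* -b/a Base.≈ Base.- b
      a*-b/a = Base.trans (Base.sym (Base.*-assoc _ _ _))
        (Base.trans (Base.*-congʳ (Base.⁻¹-inverse a≉0)) (Base.*-identityˡ _))

    -- By linearity, scaling an eigenvector by an element of the base field keeps its eigenvalue.
    eigenvalue-unique : ∀ {m n h k} → ¬ (h ≈ 0#) → φ h ≈ m * h → φ k ≈ n * k →
                        (∃ λ c → h ≈ ι c * k) → m ≈ n
    eigenvalue-unique {m} {n} {h} {k} h≉0 φh φk (c , h≈ck) = *-cancelˡ h≉0 (begin
      h * m            ≈⟨ *-comm _ _ ⟩
      m * h            ≈⟨ φh ⟨
      φ h              ≈⟨ φ-cong h≈ck ⟩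
      φ (ι c * k)      ≈⟨ φ-ι* c k ⟩
      ι c * φ k        ≈⟨ *-congˡ φk ⟩
      ι c * (n * k)    ≈⟨ x∙yz≈y∙xz _ _ _ ⟩
      n * (ι c * k)    ≈⟨ *-congˡ h≈ck ⟨
      n * h            ≈⟨ *-comm _ _ ⟩
      h * n            ∎)

    -- Eigenspaces are lines over the base field, which is why the twisted product does not depend
    -- on the chosen root.
    eigenvectors-proportional : ∀ {m h k} → ¬ (k ≈ 0#) → φ h ≈ m * h → φ k ≈ m * k →
                                ∃ λ c → h ≈ ι c * k
    eigenvectors-proportional {m} {h} {k} k≉0 φh φk = proportional k≉0 (begin
      k * φ h      ≈⟨ *-congˡ φh ⟩
      k * (m * h)  ≈⟨ *-congˡ (*-comm m h) ⟩
      k * (h * m)  ≈⟨ x∙yz≈y∙xz _ _ _ ⟩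
      h * (k * m)  ≈⟨ *-congˡ (*-comm k m) ⟩
      h * (m * k)  ≈⟨ *-congˡ φk ⟨
      h * φ k      ∎)

    -- The only access to the product that the algebra below has: it sees the two branches, but
    -- neither the membership test nor the choice of roots.
    data View (_∘_ : Carrier → Carrier → Carrier) (m : Carrier) : Set (c₂ ⊔ ℓ₂) where
      ordinary : ¬ Eigenvalue m → (∀ x → x ∘ m ≈ x * m) → View _∘_ m
      conjugate : ∀ h → ¬ (h ≈ 0#) → φ h ≈ m * h →
                  (∀ x → x ∘ m ≈ h ⁻¹ * φ (h * x)) → View _∘_ m

    -- The twisted product and the quasifield axioms

    module Product
      (0-noneigen : ¬ Eigenvalue 0#) (1-noneigen : ¬ Eigenvalue 1#)
      (_∘_ : Carrier → Carrier → Carrier) (view : ∀ m → View _∘_ m)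
      where

      ∘-ordinary : ∀ {m} → ¬ Eigenvalue m → ∀ x → x ∘ m ≈ x * m
      ∘-ordinary {m} ¬ev x with view m
      ... | ordinary _ eq        = eq x
      ... | conjugate h h≉0 φh _ = contradiction (h , h≉0 , φh) ¬ev

      -- Any eigenvector `h` may replace the chosen `k`: they differ by a factor `ι c`, which passes
      -- through `φ`. Multiplying by `h` keeps its inverse out of later computations.
      ∘-eigen : ∀ {m h} → ¬ (h ≈ 0#) → φ h ≈ m * h → ∀ x → h * (x ∘ m) ≈ φ (h * x)
      ∘-eigen {m} {h} h≉0 φh x with view m
      ... | ordinary ¬ev _        = contradiction (h , h≉0 , φh) ¬ev
      ... | conjugate k k≉0 φk eq with c , h≈ck ← eigenvectors-proportional k≉0 φh φk = begin
        h * (x ∘ m)                        ≈⟨ *-cong h≈ck (eq x) ⟩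
        ι c * k * (k ⁻¹ * φ (k * x))       ≈⟨ *-assoc _ _ _ ⟩
        ι c * (k * (k ⁻¹ * φ (k * x)))     ≈⟨ *-congˡ (x*[x⁻¹*y]≈y k≉0 _) ⟩
        ι c * φ (k * x)                    ≈⟨ φ-ι* c _ ⟨
        φ (ι c * (k * x))                  ≈⟨ φ-cong (*-assoc _ _ _) ⟨
        φ (ι c * k * x)                    ≈⟨ φ-cong (*-congʳ h≈ck) ⟨
        φ (h * x)                          ∎

      eigenvalue? : ∀ m → Dec (Eigenvalue m)
      eigenvalue? m with view m
      ... | ordinary ¬ev _       = no ¬ev
      ... | conjugate h h≉0 φh _ = yes (h , h≉0 , φh)

      -- The roots chosen for `m` and `n` may differ, but `∘-eigen` accepts the same `h` on both
      -- sides.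
      ∘-cong : ∀ {x y m n} → x ≈ y → m ≈ n → x ∘ m ≈ y ∘ n
      ∘-cong {x} {y} {m} {n} x≈y m≈n with view m
      ... | ordinary ¬ev eq = begin
        x ∘ m   ≈⟨ eq x ⟩
        x * m   ≈⟨ *-cong x≈y m≈n ⟩
        y * n   ≈⟨ ∘-ordinary (¬ev ⊚ Eigenvalue-resp (sym m≈n)) y ⟨
        y ∘ n   ∎
      ... | conjugate h h≉0 φh _ = *-cancelˡ h≉0 (begin
        h * (x ∘ m)   ≈⟨ ∘-eigen h≉0 φh x ⟩
        φ (h * x)     ≈⟨ φ-cong (*-congˡ x≈y) ⟩
        φ (h * y)     ≈⟨ ∘-eigen h≉0 (trans φh (*-congʳ m≈n)) y ⟨
        h * (y ∘ n)   ∎)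

      ∘-distribʳ : ∀ m x y → (x + y) ∘ m ≈ x ∘ m + y ∘ m
      ∘-distribʳ m x y with view m
      ... | ordinary _ eq = begin
        (x + y) ∘ m        ≈⟨ eq (x + y) ⟩
        (x + y) * m        ≈⟨ distribʳ m x y ⟩
        x * m + y * m      ≈⟨ +-cong (eq x) (eq y) ⟨
        x ∘ m + y ∘ m      ∎
      ... | conjugate h _ _ eq = begin
        (x + y) ∘ m                              ≈⟨ eq (x + y) ⟩
        h ⁻¹ * φ (h * (x + y))                   ≈⟨ *-congˡ (φ-cong (distribˡ h x y)) ⟩
        h ⁻¹ * φ (h * x + h * y)                 ≈⟨ *-congˡ (φ-+ _ _) ⟩
        h ⁻¹ * (φ (h * x) + φ (h * y))           ≈⟨ distribˡ _ _ _ ⟩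
        h ⁻¹ * φ (h * x) + h ⁻¹ * φ (h * y)      ≈⟨ +-cong (eq x) (eq y) ⟨
        x ∘ m + y ∘ m                            ∎

      ι*-∘ : ∀ a x m → (ι a * x) ∘ m ≈ ι a * (x ∘ m)
      ι*-∘ a x m with view m
      ... | ordinary _ eq = begin
        (ι a * x) ∘ m     ≈⟨ eq _ ⟩
        ι a * x * m       ≈⟨ *-assoc _ _ _ ⟩
        ι a * (x * m)     ≈⟨ *-congˡ (eq x) ⟨
        ι a * (x ∘ m)     ∎
      ... | conjugate h _ _ eq = begin
        (ι a * x) ∘ m               ≈⟨ eq _ ⟩
        h ⁻¹ * φ (h * (ι a * x))    ≈⟨ *-congˡ (φ-cong (x∙yz≈y∙xz _ _ _)) ⟩
        h ⁻¹ * φ (ι a * (h * x))    ≈⟨ *-congˡ (φ-ι* a _) ⟩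
        h ⁻¹ * (ι a * φ (h * x))    ≈⟨ x∙yz≈y∙xz _ _ _ ⟩
        ι a * (h ⁻¹ * φ (h * x))    ≈⟨ *-congˡ (eq x) ⟨
        ι a * (x ∘ m)               ∎

      ∘-identityʳ : ∀ x → x ∘ 1# ≈ x
      ∘-identityʳ x = trans (∘-ordinary 1-noneigen x) (*-identityʳ x)

      ∘-identityˡ : ∀ m → 1# ∘ m ≈ m
      ∘-identityˡ m with eigenvalue? m
      ... | no  ¬ev            = trans (∘-ordinary ¬ev 1#) (*-identityˡ m)
      ... | yes (h , h≉0 , φh) = *-cancelˡ h≉0 (begin
        h * (1# ∘ m)   ≈⟨ ∘-eigen h≉0 φh 1# ⟩
        φ (h * 1#)     ≈⟨ φ-cong (*-identityʳ h) ⟩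
        φ h            ≈⟨ φh ⟩
        m * h          ≈⟨ *-comm m h ⟩
        h * m          ∎)

      ∘-zeroʳ : ∀ x → x ∘ 0# ≈ 0#
      ∘-zeroʳ x = trans (∘-ordinary 0-noneigen x) (zeroʳ x)

      ∘-zeroˡ : ∀ m → 0# ∘ m ≈ 0#
      ∘-zeroˡ m = +-identityˡ-unique _ _ (trans (sym (∘-distribʳ m 0# 0#)) (∘-cong (+-identityˡ 0#) refl))

      -- Equality would turn `h * x` into an eigenvector for `n`.
      ∘-eigen≉ordinary : ∀ {x m n} → ¬ (x ≈ 0#) → Eigenvalue m → ¬ Eigenvalue n → ¬ (x ∘ m ≈ x ∘ n)
      ∘-eigen≉ordinary {x} {m} {n} x≉0 (h , h≉0 , φh) ¬ev eq = ¬ev (h * x , *-nonzero h≉0 x≉0 , (begin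
        φ (h * x)    ≈⟨ ∘-eigen h≉0 φh x ⟨
        h * (x ∘ m)  ≈⟨ *-congˡ (trans eq (∘-ordinary ¬ev x)) ⟩
        h * (x * n)  ≈⟨ *-assoc _ _ _ ⟨
        h * x * n    ≈⟨ *-comm _ _ ⟩
        n * (h * x)  ∎))

      -- In the case of two eigenvalues, `φ` multiplies both `h * x` and `k * x` by the common ratio
      -- of `x ∘ m` to `x`. Scatteredness makes these proportional, hence also `h` and `k`, so their
      -- eigenvalues agree.
      ∘-cancelˡ : ∀ {x m n} → ¬ (x ≈ 0#) → x ∘ m ≈ x ∘ n → m ≈ n
      ∘-cancelˡ {x} {m} {n} x≉0 eq with eigenvalue? m | eigenvalue? n
      ... | no ¬m-ev | no ¬n-ev =
        *-cancelˡ x≉0 (trans (sym (∘-ordinary ¬m-ev x)) (trans eq (∘-ordinary ¬n-ev x)))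
      ... | yes m-ev | no ¬n-ev = contradiction eq (∘-eigen≉ordinary x≉0 m-ev ¬n-ev)
      ... | no ¬m-ev | yes n-ev = contradiction (sym eq) (∘-eigen≉ordinary x≉0 n-ev ¬m-ev)
      ... | yes (h , h≉0 , φh) | yes (k , k≉0 , φk)
          with c , hx≈ckx ← proportional (*-nonzero k≉0 x≉0) (begin
            k * x * φ (h * x)      ≈⟨ *-congˡ (∘-eigen h≉0 φh x) ⟨
            k * x * (h * (x ∘ m))  ≈⟨ interchange k x h _ ⟩
            k * h * (x * (x ∘ m))  ≈⟨ *-cong (*-comm k h) (*-congˡ eq) ⟩
            h * k * (x * (x ∘ n))  ≈⟨ interchange h k x _ ⟩
            h * x * (k * (x ∘ n))  ≈⟨ *-congˡ (∘-eigen k≉0 φk x) ⟩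
            h * x * φ (k * x)      ∎) =
        eigenvalue-unique h≉0 φh φk (c , *-cancelˡ x≉0 (begin
          x * h          ≈⟨ *-comm x h ⟩
          h * x          ≈⟨ hx≈ckx ⟩
          ι c * (k * x)  ≈⟨ *-assoc _ _ _ ⟨
          ι c * k * x    ≈⟨ *-comm _ x ⟩
          x * (ι c * k)  ∎))

      ∘-nonzero : ∀ {x m} → ¬ (x ≈ 0#) → ¬ (m ≈ 0#) → ¬ (x ∘ m ≈ 0#)
      ∘-nonzero x≉0 m≉0 eq = m≉0 (∘-cancelˡ x≉0 (trans eq (sym (∘-zeroʳ _))))

      ∘-‿distribʳ : ∀ m x y → (x - y) ∘ m ≈ x ∘ m - y ∘ m
      ∘-‿distribʳ m x y = trans (∘-distribʳ m x (- y)) (+-congˡ (+-inverseʳ-unique _ _ (begin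
        y ∘ m + (- y) ∘ m   ≈⟨ ∘-distribʳ m y (- y) ⟨
        (y - y) ∘ m          ≈⟨ ∘-cong (-‿inverseʳ y) refl ⟩
        0# ∘ m               ≈⟨ ∘-zeroˡ m ⟩
        0#                    ∎)))

      -- The difference `D` of the two sides' products is additive, and a nonzero zero of `D` would
      -- give `a ≈ b` by left cancellation. So `D` is injective, and bijective by finiteness.
      uniquelySolvable : ∀ a b c → ¬ (a ≈ b) → ∃! _≈_ λ x → x ∘ a ≈ (x ∘ b) + c
      uniquelySolvable a b c a≉b = let x , Dx≈c = surjective D-injective c in
        x , D≈c⇒solution Dx≈c , λ {y} y-solves → D-injective (trans Dx≈c (sym (solution⇒D≈c y-solves)))
        where
        D : Carrier → Carrier
        D x = x ∘ a - x ∘ b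

        D≈c⇒solution : ∀ {x} → D x ≈ c → x ∘ a ≈ (x ∘ b) + c
        D≈c⇒solution {x} Dx≈c = begin
          x ∘ a                  ≈⟨ x+[y-x]≈y (x ∘ b) (x ∘ a) ⟨
          x ∘ b + D x            ≈⟨ +-congˡ Dx≈c ⟩
          x ∘ b + c              ∎
          where
          x+[y-x]≈y : ∀ x y → x + (y - x) ≈ y
          x+[y-x]≈y x y = trans (sym (+-assoc x y (- x))) (xyx⁻¹≈y x y)

        solution⇒D≈c : ∀ {x} → x ∘ a ≈ (x ∘ b) + c → D x ≈ c
        solution⇒D≈c {x} eq = trans (+-congʳ eq) (xyx⁻¹≈y (x ∘ b) c)

        D-additive : ∀ x y → D (x - y) ≈ D x - D y
        D-additive x y = begin
          (x - y) ∘ a - (x - y) ∘ b                    ≈⟨ +-cong (∘-‿distribʳ a x y) (-‿cong (∘-‿distribʳ b x y)) ⟩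
          (x ∘ a - y ∘ a) - (x ∘ b - y ∘ b)            ≈⟨ +-congˡ (⁻¹-∙-comm _ _) ⟨
          (x ∘ a - y ∘ a) + (- (x ∘ b) - - (y ∘ b))    ≈⟨ +-interchange _ _ _ _ ⟩
          D x + (- (y ∘ a) - - (y ∘ b))                ≈⟨ +-congˡ (⁻¹-∙-comm _ _) ⟩
          D x - D y                                    ∎

        D-injective : Injective _≈_ _≈_ D
        D-injective {x} {y} Dx≈Dy = decidable-stable (x ≟ y) λ x≉y →
          a≉b (∘-cancelˡ (x≉y ⊚ x-y≈0⇒x≈y x y)
            (x-y≈0⇒x≈y _ _ (trans (D-additive x y) (x≈y⇒x-y≈0 Dx≈Dy))))

      leftSolvable : ∀ {a} → ¬ (a ≈ 0#) → ∀ b → ∃ λ x → a ∘ x ≈ b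
      leftSolvable a≉0 = surjective (∘-cancelˡ a≉0)

      -- As `x ∘ 0#` vanishes, right division is the quasifield equation with second multiplier
      -- zero.
      rightSolvable : ∀ {a} → ¬ (a ≈ 0#) → ∀ b → ∃ λ x → x ∘ a ≈ b
      rightSolvable {a} a≉0 b = let x , eq , _ = uniquelySolvable a 0# b a≉0 in
        x , trans eq (trans (+-congʳ (∘-zeroʳ x)) (+-identityˡ b))

      ∘-cancelʳ : ∀ {a x y} → ¬ (a ≈ 0#) → x ∘ a ≈ y ∘ a → x ≈ y
      ∘-cancelʳ {a} {x} {y} a≉0 eq = let _ , _ , unique = uniquelySolvable a 0# (y ∘ a) a≉0 in
        trans (sym (unique (trans eq (0+ x)))) (unique (0+ y))
        where
        0+ : ∀ z → y ∘ a ≈ (z ∘ 0#) + y ∘ a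
        0+ z = sym (trans (+-congʳ (∘-zeroʳ z)) (+-identityˡ _))

      isRightQuasifield : IsRightQuasifield _≈_ _+_ 0# -_ _∘_
      isRightQuasifield = record
        { +-isAbelianGroup = +-isAbelianGroup
        ; ∘-cong           = ∘-cong
        ; ∘-nonzero        = ∘-nonzero
        ; _\\_             = _\\_
        ; _//_             = _//_
        ; ε                = 1# , 0≉1 ⊚ sym
        ; ∘*-isLoop        = record
          { isQuasigroup = record
            { isMagma = record
              { isEquivalence = record { refl = refl ; sym = sym ; trans = trans }
              ; ∙-cong        = ∘-cong
              }
            -- Cancellation yields congruence of the quotients whatever witnesses the search
            -- returns.
            ; \\-cong       = λ {x} {y} {u} {v} x≈y u≈v → ∘-cancelˡ (proj₂ x) (begin
                proj₁ x ∘ proj₁ (x \\ u)  ≈⟨ \\-divides x u ⟩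
                proj₁ u                   ≈⟨ u≈v ⟩
                proj₁ v                   ≈⟨ \\-divides y v ⟨
                proj₁ y ∘ proj₁ (y \\ v)  ≈⟨ ∘-cong x≈y refl ⟨
                proj₁ x ∘ proj₁ (y \\ v)  ∎)
            ; //-cong       = λ {x} {y} {u} {v} x≈y u≈v → ∘-cancelʳ (proj₂ u) (begin
                proj₁ (x // u) ∘ proj₁ u  ≈⟨ //-divides u x ⟩
                proj₁ x                   ≈⟨ x≈y ⟩
                proj₁ y                   ≈⟨ //-divides v y ⟨
                proj₁ (y // v) ∘ proj₁ v  ≈⟨ ∘-cong refl u≈v ⟨
                proj₁ (y // v) ∘ proj₁ u  ∎)
            ; leftDivides   = \\-divides , λ x y → ∘-cancelˡ (proj₂ x) (\\-divides x (x ∘* y))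
            ; rightDivides  = //-divides , λ x y → ∘-cancelʳ (proj₂ x) (//-divides x (y ∘* x))
            }
          ; identity = (λ x → ∘-identityˡ (proj₁ x)) , (λ x → ∘-identityʳ (proj₁ x))
          }
        ; distribʳ         = ∘-distribʳ
        ; uniquelySolvable = uniquelySolvable
        }
        where
        NonZeroElement = ∃ λ x → ¬ (x ≈ 0#)
        _∘*_ _\\_ _//_ : NonZeroElement → NonZeroElement → NonZeroElement
        (x , x≉0) ∘* (y , y≉0) = x ∘ y , ∘-nonzero x≉0 y≉0
        (x , x≉0) \\ (y , y≉0) = let z , xz≈y = leftSolvable x≉0 y in
          z , λ z≈0 → y≉0 (trans (sym xz≈y) (trans (∘-cong refl z≈0) (∘-zeroʳ x)))
        (x , x≉0) // (y , y≉0) = let z , zy≈x = rightSolvable y≉0 x in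
          z , λ z≈0 → x≉0 (trans (sym zy≈x) (trans (∘-cong z≈0 refl) (∘-zeroˡ y)))
        \\-divides : ∀ x y → proj₁ x ∘ proj₁ (x \\ y) ≈ proj₁ y
        \\-divides (x , x≉0) (y , _) = proj₂ (leftSolvable x≉0 y)
        //-divides : ∀ x y → proj₁ (y // x) ∘ proj₁ x ≈ proj₁ y
        //-divides (x , x≉0) (y , _) = proj₂ (rightSolvable x≉0 y)

      -- The kernel

      ι-∘ : ∀ a x → ι a ∘ x ≈ ι a * x
      ι-∘ a x = begin
        ι a ∘ x          ≈⟨ ∘-cong (*-identityʳ _) refl ⟨
        (ι a * 1#) ∘ x   ≈⟨ ι*-∘ a 1# x ⟩
        ι a * (1# ∘ x)   ≈⟨ *-congˡ (∘-identityˡ x) ⟩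
        ι a * x          ∎

      𝔽q⊆Kernel : ∀ {k} → k ∈ 𝔽q → k ∈ Kernel _≈_ _+_ _∘_
      𝔽q⊆Kernel {k} (a , ιa≈k) x y = additive , associative
        where
        k∘ : ∀ z → k ∘ z ≈ ι a * z
        k∘ z = trans (∘-cong (sym ιa≈k) refl) (ι-∘ a z)
        additive : k ∘ (x + y) ≈ (k ∘ x) + (k ∘ y)
        additive = begin
          k ∘ (x + y)           ≈⟨ k∘ (x + y) ⟩
          ι a * (x + y)         ≈⟨ distribˡ _ _ _ ⟩
          ι a * x + ι a * y     ≈⟨ +-cong (k∘ x) (k∘ y) ⟨
          (k ∘ x) + (k ∘ y)     ∎
        associative : k ∘ (x ∘ y) ≈ (k ∘ x) ∘ y
        associative = begin
          k ∘ (x ∘ y)           ≈⟨ k∘ (x ∘ y) ⟩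
          ι a * (x ∘ y)         ≈⟨ ι*-∘ a x y ⟨
          (ι a * x) ∘ y         ≈⟨ ∘-cong (k∘ x) refl ⟨
          (k ∘ x) ∘ y           ∎

      -- The hypothesis makes `h * k` a second eigenvector for `m`, hence a base field multiple of
      -- `h`; cancelling `h` leaves `k`.
      k∘m≈k*m⇒k∈𝔽q : ∀ {k m} → Eigenvalue m → k ∘ m ≈ k * m → k ∈ 𝔽q
      k∘m≈k*m⇒k∈𝔽q {k} {m} (h , h≉0 , φh) eq
        with c , hk≈ch ← proportional h≉0 (begin
          h * φ (h * k)      ≈⟨ *-congˡ (∘-eigen h≉0 φh k) ⟨
          h * (h * (k ∘ m))  ≈⟨ *-congˡ (*-congˡ eq) ⟩
          h * (h * (k * m))  ≈⟨ *-congˡ (*-assoc h k m) ⟨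
          h * (h * k * m)    ≈⟨ x∙yz≈y∙zx _ _ _ ⟩
          h * k * (m * h)    ≈⟨ *-congˡ φh ⟨
          h * k * φ h        ∎) =
        c , *-cancelˡ h≉0 (trans (*-comm _ _) (sym hk≈ch))

      -- Off the eigenvalues k ∘ m is k * m; on them it is not, unless k ∈ 𝔽q.
      -- Hence an additive k ∘_ forces this closure property when k ∉ 𝔽q.
      noneigen+eigen : ∀ {k} → k ∈ Kernel _≈_ _+_ _∘_ → k ∉ 𝔽q →
                       ∀ {u v} → ¬ Eigenvalue u → Eigenvalue v → Eigenvalue (u + v)
      noneigen+eigen {k} k∈K k∉𝔽q {u} {v} ¬u-ev v-ev = decidable-stable (eigenvalue? (u + v)) λ ¬ev →
        k∉𝔽q (k∘m≈k*m⇒k∈𝔽q v-ev (+-cancelˡ (k * u) _ _ (begin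
          k * u + (k ∘ v)       ≈⟨ +-congʳ (∘-ordinary ¬u-ev k) ⟨
          (k ∘ u) + (k ∘ v)     ≈⟨ proj₁ (k∈K u v) ⟨
          k ∘ (u + v)           ≈⟨ ∘-ordinary ¬ev k ⟩
          k * (u + v)           ≈⟨ distribˡ k u v ⟩
          k * u + k * v         ∎)))

      -- Counting eigenvectors

      indexedEigenvector : Fin (q ℕ.^ t) → Carrier
      indexedEigenvector i with eigenvalue? (to i)
      ... | yes (h , _) = h
      -- A default value: `Φ` below evaluates `eigenvector` only at eigenvalues.
      ... | no  _       = 0#

      -- The detour through the index makes the chosen eigenvector respect _≈_.
      eigenvector : Carrier → Carrier
      eigenvector m = indexedEigenvector (from m)

      eigenvector-cong : ∀ {m n} → m ≈ n → eigenvector m ≡ eigenvector n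
      eigenvector-cong m≈n = ≡.cong indexedEigenvector (from-cong m≈n)

      eigenvector-spec : ∀ {m} → Eigenvalue m →
                         ¬ (eigenvector m ≈ 0#) × φ (eigenvector m) ≈ m * eigenvector m
      eigenvector-spec {m} m-ev with eigenvalue? (to (from m))
      ... | yes (h , h≉0 , φh) = h≉0 , trans φh (*-congʳ (strictlyInverseˡ m))
      ... | no  ¬ev            = contradiction (Eigenvalue-resp (sym (strictlyInverseˡ m)) m-ev) ¬ev

      -- If U is the set of noneigenvalues and U + v consists of eigenvalues, the
      -- chosen eigenvectors of eigenvalues m and c times those of u + v (u ∈ U)
      -- embed the whole field into its nonzero elements.
      ¬noneigen+eigen : ∀ c → ¬ (ι c ≈ 0#) → ¬ (ι c ≈ 1#) → ∀ v →
                        ¬ (∀ {u} → ¬ Eigenvalue u → Eigenvalue (u + v))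
      ¬noneigen+eigen c ιc≉0 ιc≉1 v shift = let m , Φm≈0 = surjective Φ-injective 0# in Φ≉0 m Φm≈0
        where
        Φ : Carrier → Carrier
        Φ m with eigenvalue? m
        ... | yes _ = eigenvector m
        ... | no  _ = ι c * eigenvector (m + v)

        Φ≉0 : ∀ m → ¬ (Φ m ≈ 0#)
        Φ≉0 m with eigenvalue? m
        ... | yes m-ev  = proj₁ (eigenvector-spec m-ev)
        ... | no  ¬m-ev = *-nonzero ιc≉0 (proj₁ (eigenvector-spec (shift ¬m-ev)))

        sameEigenvalue : ∀ {m n} → Eigenvalue m → Eigenvalue n → ∀ c →
                         eigenvector m ≈ ι c * eigenvector n → m ≈ n
        sameEigenvalue m-ev n-ev c eq = let h≉0 , φh = eigenvector-spec m-ev in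
          eigenvalue-unique h≉0 φh (proj₂ (eigenvector-spec n-ev)) (c , eq)

        ι1* : ∀ x → ι Base.1# * x ≈ x
        ι1* x = trans (*-congʳ ι-1) (*-identityˡ x)

        -- Proportional eigenvectors share their eigenvalue, so both chosen ones coincide, and the
        -- factor would have to be one.
        images-disjoint : ∀ {m n} → Eigenvalue m → Eigenvalue n → ¬ (eigenvector m ≈ ι c * eigenvector n)
        images-disjoint {m} {n} m-ev n-ev eq = ιc≉1 (*-cancelˡ (proj₁ (eigenvector-spec n-ev)) (begin
          eigenvector n * ι c  ≈⟨ *-comm _ _ ⟩
          ι c * eigenvector n  ≈⟨ eq ⟨
          eigenvector m        ≡⟨ eigenvector-cong (sameEigenvalue m-ev n-ev c eq) ⟩
          eigenvector n        ≈⟨ *-identityʳ _ ⟨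
          eigenvector n * 1#   ∎))

        Φ-injective : Injective _≈_ _≈_ Φ
        Φ-injective {m} {n} eq with eigenvalue? m | eigenvalue? n
        ... | yes m-ev  | yes n-ev  = sameEigenvalue m-ev n-ev Base.1# (trans eq (sym (ι1* _)))
        ... | yes m-ev  | no  ¬n-ev = contradiction eq (images-disjoint m-ev (shift ¬n-ev))
        ... | no  ¬m-ev | yes n-ev  = contradiction (sym eq) (images-disjoint n-ev (shift ¬m-ev))
        ... | no  ¬m-ev | no  ¬n-ev = +-cancelʳ v m n
          (sameEigenvalue (shift ¬m-ev) (shift ¬n-ev) Base.1#
            (trans (*-cancelˡ ιc≉0 eq) (sym (ι1* _))))

      Kernel⊆𝔽q : 2 < q → ∀ {k} → k ∈ Kernel _≈_ _+_ _∘_ → k ∈ 𝔽q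
      Kernel⊆𝔽q 2<q {k} k∈K = decidable-stable (∈𝔽q? k) λ k∉𝔽q →
        let c , c≉0 , c≉1 = BaseProperties.element≉0,1 2<q in
        -- The translation is by `φ 1#`, an eigenvalue with eigenvector `1#`; the scalar `c` comes
        -- from `2 < q`.
        ¬noneigen+eigen c (ι≉0 c≉0) (λ ιc≈1 → c≉1 (ι-injective (trans ιc≈1 (sym ι-1)))) (φ 1#)
          (λ ¬u-ev → noneigen+eigen k∈K k∉𝔽q ¬u-ev (1# , 0≉1 ⊚ sym , sym (*-identityʳ _)))

-- The theorem for scattered polynomials

proposition3p1 : ∀ {c₁ ℓ₁ c₂ ℓ₂ : Level} (q t : ℕ) → IsPrimePower q → 2 < q → 1 < t →
    (E : Extension c₁ ℓ₁ c₂ ℓ₂ q t) →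
    let open Extension.Top E
        open Linearized E
    in
    (f : LinearizedPolynomial) → Scattered f → 0# ∉ L f → 1# ∉ L f →
    (root : Choice f) →
    IsRightQuasifield _≈_ _+_ 0# -_ (twisted f root) ×
    (Kernel _≈_ _+_ (twisted f root) ≐ 𝔽q)
proposition3p1 q t q-primePower 2<q _ E f scattered 0∉L 1∉L root =
  isRightQuasifield , Kernel⊆𝔽q 2<q , 𝔽q⊆Kernel
  where
  open Extension E
  open Top
  open Linearized E
  open TwistedMultiplication q-primePower E
  open FiniteFieldProperties top using (x*[x⁻¹*y]≈y)
  open ScatteredMap ⟦ f ⟧ (⟦⟧-cong f) (⟦⟧-+ f) (⟦⟧-ι* f) scattered
  open GroupProperties +-group using () renaming (x∙y⁻¹≈ε⇒x≈y to x-y≈0⇒x≈y)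

  Eigenvalue⇒∈L : ∀ {m} → Eigenvalue m → m ∈ L f
  Eigenvalue⇒∈L {m} (h , h≉0 , φh) = h , h≉0 , (begin
    m               ≈⟨ x*[x⁻¹*y]≈y h≉0 m ⟨
    h * (h ⁻¹ * m)  ≈⟨ x∙yz≈zx∙y h (h ⁻¹) m ⟩
    m * h * h ⁻¹    ≈⟨ *-congʳ φh ⟨
    ⟦ f ⟧ h * h ⁻¹  ∎)
    where
    open SetoidReasoning setoid
    open CommutativeSemigroupProperties *-commutativeSemigroup using (x∙yz≈zx∙y)

  view : ∀ m → View (twisted f root) m
  -- Keeping `eq` lets `twisted`, which is blocked on the same test, reduce in each branch.
  view m with m ∈L? f in eq
  ... | no m∉L = ordinary (m∉L ⊚ Eigenvalue⇒∈L) λ x → reflexive (twisted-no x)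
    where
    twisted-no : ∀ x → twisted f root x m ≡ x * m
    twisted-no x rewrite eq = ≡.refl
  ... | yes m∈L = conjugate h h≉0 (x-y≈0⇒x≈y _ _ root-eq) λ x → reflexive (twisted-yes x)
    where
    h = proj₁ (root m m∈L)
    h≉0 = proj₁ (proj₂ (root m m∈L))
    root-eq = proj₂ (proj₂ (root m m∈L))
    twisted-yes : ∀ x → twisted f root x m ≡ h ⁻¹ * ⟦ f ⟧ (h * x)
    twisted-yes x rewrite eq = ≡.refl

  open Product (0∉L ⊚ Eigenvalue⇒∈L) (1∉L ⊚ Eigenvalue⇒∈L) (twisted f root) view
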